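{- Let $G$ be an infinite group. Then (i) $BR_G$ is a translation invariant ideal in $\mathcal{P}_G$; (ii) $BR_G^{\wedge}$ is a closed ideal of the semigroup $\beta G$, and an ultrafilter $p\in\beta G$ belongs to $BR_G^{\wedge}$ if and only if every member $P\in p$ contains an $(n,n)$-rectangle for every $n\in\mathbb{N}$; (iii) $BR_G\subsetneq FT_G$.
   Context: For $X,Y\subseteq G$, the product $XY$ is an $(n,m)$-rectangle if $|X|=n$, $|Y|=m$; a set $A$ has (contains) an $(n,m)$-rectangle if $XY\subseteq A$ for some such $X,Y$. $A$ has bounded rectangles if there is $n\in\mathbb{N}$ such that $A$ contains no $(n,n)$-rectangle; $BR_G$ is the family of such sets. An ideal in $\mathcal{P}_G$ is a family closed under finite unions and subsets not containing $G$; it is translation invariant if $gA,Ag$ belong to it whenever $A$ does. $A$ is $n$-thin if $g_0A\cap\dots\cap g_nA$ is finite for all distinct $g_0,\dots,g_n$; $FT_G$ is the family of sets that are $n$-thin for some $n$. $\beta G$ is the semigroup of ultrafilters on $G$, and $\mathcal{I}^{\wedge}=\{p\in\beta G: G\setminus A\in p$ for each $A\in\mathcal{I}\}$. -}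

module Defs where

open import Algebra.Bundles using (Group; Semigroup)
open import Data.Fin.Base using (Fin)
open import Data.Nat.Base using (ℕ; suc)
open import Data.Product.Base using (∃; ∃₂; _×_; _,_; proj₁; proj₂)
open import Data.Sum.Base using (_⊎_; inj₁; inj₂; map₂)
open import Function.Base using (_∘_)
open import Function.Bundles using (Inverse; _⇔_; mk⇔; Equivalence)
open import Function.Definitions using (Injective)
open import Level using (Level; _⊔_; lift) renaming (suc to lsuc)
open import Relation.Binary.Bundles using (Setoid; Poset)
import Relation.Binary.Construct.On as On
open import Relation.Binary.Definitions using (_Respects_)
open import Relation.Binary.PropositionalEquality using (_≡_; setoid)
open import Relation.Nullary using (¬_; contradiction)
open import Relation.Unary using (Pred; Satisfiable) renaming
  (_∈_ to _∈ᵤ_; _⊆_ to _⊆ᵤ_; _∪_ to _∪ᵤ_; _∩_ to _∩ᵤ_; ∁ to ∁ᵤ)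
import Relation.Unary.Polymorphic as Polymorphic

private
  variable
    a b ℓ ℓ′ : Level

HasCardinality : ℕ → Setoid a b → Set (a ⊔ b)
HasCardinality n S = Inverse (setoid (Fin n)) S

Finite : Setoid a b → Set (a ⊔ b)
Finite S = ∃ λ n → HasCardinality n S

-- Zorn's lemma, as a proposition. It serves as the ambient axiom of choice;
-- the empty chain forces the poset to be inhabited.
Zorn : ∀ a → Set (lsuc a)
Zorn a = (P : Poset a a a) → let open Poset P in
  ((C : Pred Carrier a) →
     (∀ x y → x ∈ᵤ C → y ∈ᵤ C → x ≤ y ⊎ y ≤ x) →
     ∃ λ u → ∀ x → x ∈ᵤ C → x ≤ u) →
  ∃ λ m → ∀ x → m ≤ x → x ≈ m

record IsSemigroupIdeal (S : Semigroup a b)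
                        (I : Pred (Semigroup.Carrier S) ℓ) : Set (a ⊔ b ⊔ ℓ) where
  open Semigroup S
  field
    respects : I Respects _≈_
    nonempty : Satisfiable I
    absorbˡ  : ∀ x y → y ∈ᵤ I → (x ∙ y) ∈ᵤ I
    absorbʳ  : ∀ x y → x ∈ᵤ I → (x ∙ y) ∈ᵤ I

module GroupSubsets {c ℓ : Level} (G : Group c ℓ) where

  open Group G renaming (setoid to ≈-setoid)

  -- The level of subsets of G. Membership in an ultrafilter lives at the same
  -- level, so that {g : g⁻¹A ∈ q} is again a subset of G; under excluded middle
  -- this bound on levels excludes no subsets and no ultrafilters.
  s : Level
  s = c ⊔ ℓ

  infix  4 _∈_ _⊆_
  infixr 7 _∩_ _·_ _·ˡ_ _·ʳ_
  infixr 6 _∪_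

  record Subset : Set (lsuc s) where
    constructor ⟨_,_⟩
    field
      pred     : Pred Carrier s
      respects : pred Respects _≈_

  open Subset

  _∈_ : Carrier → Subset → Set s
  x ∈ A = pred A x

  _⊆_ : Subset → Subset → Set s
  A ⊆ B = pred A ⊆ᵤ pred B

  ∅ : Subset
  ∅ = ⟨ Polymorphic.∅ , (λ _ ()) ⟩

  whole : Subset
  whole = ⟨ Polymorphic.U , (λ _ t → t) ⟩

  _∪_ : Subset → Subset → Subset
  A ∪ B = ⟨ pred A ∪ᵤ pred B
          , (λ { x≈y (inj₁ x∈A) → inj₁ (respects A x≈y x∈A)
               ; x≈y (inj₂ x∈B) → inj₂ (respects B x≈y x∈B) }) ⟩

  _∩_ : Subset → Subset → Subset
  A ∩ B = ⟨ pred A ∩ᵤ pred B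
          , (λ x≈y (x∈A , x∈B) → respects A x≈y x∈A , respects B x≈y x∈B) ⟩

  ⋂ : ∀ {n} → (Fin n → Subset) → Subset
  ⋂ A = ⟨ (λ x → ∀ i → x ∈ A i) , (λ x≈y x∈ i → respects (A i) x≈y (x∈ i)) ⟩

  ∁ : Subset → Subset
  ∁ A = ⟨ ∁ᵤ (pred A) , (λ x≈y x∉A y∈A → x∉A (respects A (sym x≈y) y∈A)) ⟩

  _·_ : Subset → Subset → Subset
  X · Y = ⟨ (λ z → ∃₂ λ x y → x ∈ X × y ∈ Y × z ≈ x ∙ y)
          , (λ z≈z′ (x , y , x∈X , y∈Y , z≈xy) →
               x , y , x∈X , y∈Y , trans (sym z≈z′) z≈xy) ⟩

  _·ˡ_ : Carrier → Subset → Subset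
  g ·ˡ A = ⟨ (λ z → ∃ λ x → x ∈ A × z ≈ g ∙ x)
           , (λ z≈z′ (x , x∈A , z≈gx) → x , x∈A , trans (sym z≈z′) z≈gx) ⟩

  _·ʳ_ : Subset → Carrier → Subset
  A ·ʳ g = ⟨ (λ z → ∃ λ x → x ∈ A × z ≈ x ∙ g)
           , (λ z≈z′ (x , x∈A , z≈xg) → x , x∈A , trans (sym z≈z′) z≈xg) ⟩

  subsetoid : Subset → Setoid s ℓ
  subsetoid A = On.setoid {B = ∃ (pred A)} ≈-setoid proj₁

  Infinite : Set s
  Infinite = ¬ Finite ≈-setoid

  ContainsRectangle : ℕ → ℕ → Subset → Set (lsuc s)
  ContainsRectangle n m A = ∃₂ λ X Y →
    HasCardinality n (subsetoid X) × HasCardinality m (subsetoid Y) × X · Y ⊆ A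

  -- Every set contains a (0,0)-rectangle, so the n found here is positive.
  BR : Pred Subset (lsuc s)
  BR A = ∃ λ n → ¬ ContainsRectangle n n A

  Thin : ℕ → Subset → Set s
  Thin n A = (g : Fin (suc n) → Carrier) → Injective _≡_ _≈_ g →
    Finite (subsetoid (⋂ λ i → g i ·ˡ A))

  FT : Pred Subset s
  FT A = ∃ λ n → Thin n A

  record IsIdeal (I : Pred Subset ℓ′) : Set (lsuc s ⊔ ℓ′) where
    field
      ∅∈       : ∅ ∈ᵤ I
      ∪-closed : ∀ A B → A ∈ᵤ I → B ∈ᵤ I → (A ∪ B) ∈ᵤ I
      ⊆-closed : ∀ A B → A ⊆ B → B ∈ᵤ I → A ∈ᵤ I
      whole∉   : ¬ (whole ∈ᵤ I)

  TranslationInvariant : Pred Subset ℓ′ → Set (lsuc s ⊔ ℓ′)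
  TranslationInvariant I =
    ∀ g A → A ∈ᵤ I → (g ·ˡ A) ∈ᵤ I × (A ·ʳ g) ∈ᵤ I

  record Ultrafilter : Set (lsuc s) where
    field
      sets     : Pred Subset s
      whole∈   : whole ∈ᵤ sets
      ∅∉       : ¬ (∅ ∈ᵤ sets)
      ⊆-closed : ∀ {A B} → A ⊆ B → A ∈ᵤ sets → B ∈ᵤ sets
      ∩-closed : ∀ {A B} → A ∈ᵤ sets → B ∈ᵤ sets → (A ∩ B) ∈ᵤ sets
      ultra    : ∀ A → A ∈ᵤ sets ⊎ ∁ A ∈ᵤ sets

  open Ultrafilter

  infix 4 _≈ᵘ_
  _≈ᵘ_ : Ultrafilter → Ultrafilter → Set (lsuc s)
  p ≈ᵘ q = ∀ A → A ∈ᵤ sets p ⇔ A ∈ᵤ sets q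

  ∈-translate⁻ : ∀ g A {h} → h ∈ (g ⁻¹) ·ˡ A → g ∙ h ∈ A
  ∈-translate⁻ g A {h} (x , x∈A , h≈g⁻¹x) = respects A (sym gh≈x) x∈A
    where
    gh≈x : g ∙ h ≈ x
    gh≈x = trans (∙-congˡ h≈g⁻¹x)
             (trans (sym (assoc g (g ⁻¹) x))
               (trans (∙-congʳ (inverseʳ g)) (identityˡ x)))

  ∈-translate⁺ : ∀ g A {h} → g ∙ h ∈ A → h ∈ (g ⁻¹) ·ˡ A
  ∈-translate⁺ g A {h} gh∈A = g ∙ h , gh∈A ,
    sym (trans (sym (assoc (g ⁻¹) g h)) (trans (∙-congʳ (inverseˡ g)) (identityˡ h)))

  quotientSet : Ultrafilter → Subset → Subset
  quotientSet q A =
    ⟨ (λ g → ((g ⁻¹) ·ˡ A) ∈ᵤ sets q)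
    , (λ {g} {g′} g≈g′ → ⊆-closed q λ h∈ →
         ∈-translate⁺ g′ A (respects A (∙-congʳ g≈g′) (∈-translate⁻ g A h∈))) ⟩

  -- A ∈ p ∙ q  iff  {g : g⁻¹A ∈ q} ∈ p.
  infixl 7 _∙ᵘ_
  _∙ᵘ_ : Ultrafilter → Ultrafilter → Ultrafilter
  p ∙ᵘ q = record
    { sets     = λ A → quotientSet q A ∈ᵤ sets p
    ; whole∈   = ⊆-closed p
        (λ {g} _ → ⊆-closed q (λ _ → ∈-translate⁺ g whole (lift _)) (whole∈ q))
        (whole∈ p)
    ; ∅∉       = λ m → ∅∉ p (⊆-closed p
        (λ {g} m′ → lift (∅∉ q (⊆-closed q (∈-translate⁻ g ∅) m′))) m)
    ; ⊆-closed = λ {A} {B} A⊆B → ⊆-closed p λ {g} → ⊆-closed q λ h∈ →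
        ∈-translate⁺ g B (A⊆B (∈-translate⁻ g A h∈))
    ; ∩-closed = λ {A} {B} mA mB → ⊆-closed p
        (λ {g} (gA , gB) → ⊆-closed q
          (λ (hA , hB) →
             ∈-translate⁺ g (A ∩ B) (∈-translate⁻ g A hA , ∈-translate⁻ g B hB))
          (∩-closed q gA gB))
        (∩-closed p mA mB)
    ; ultra    = λ A → map₂ (⊆-closed p (λ {g} → complement A g))
                            (ultra p (quotientSet q A))
    }
    where
    complement : ∀ A g → ¬ (((g ⁻¹) ·ˡ A) ∈ᵤ sets q) → ((g ⁻¹) ·ˡ ∁ A) ∈ᵤ sets q
    complement A g ∉q with ultra q ((g ⁻¹) ·ˡ A)
    ... | inj₁ ∈q = contradiction ∈q ∉q
    ... | inj₂ ∁∈q = ⊆-closed q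
      (λ h∉ → ∈-translate⁺ g (∁ A) (λ gh∈A → h∉ (∈-translate⁺ g A gh∈A))) ∁∈q

  βG : Semigroup (lsuc s) (lsuc s)
  βG = record
    { Carrier     = Ultrafilter
    ; _≈_         = _≈ᵘ_
    ; _∙_         = _∙ᵘ_
    ; isSemigroup = record
      { isMagma = record
        { isEquivalence = record
          { refl  = λ A → mk⇔ (λ m → m) (λ m → m)
          ; sym   = λ p≈q A → mk⇔ (from (p≈q A)) (to (p≈q A))
          ; trans = λ p≈q q≈r A →
              mk⇔ (to (q≈r A) ∘ to (p≈q A)) (from (p≈q A) ∘ from (q≈r A))
          }
        ; ∙-cong = λ {p} {p′} {q} {q′} p≈p′ q≈q′ A → mk⇔
            (λ m → ⊆-closed p′ (to (q≈q′ _)) (to (p≈p′ _) m))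
            (λ m → ⊆-closed p (from (q≈q′ _)) (from (p≈p′ _) m))
        }
      ; assoc = λ p q r A → mk⇔
          (⊆-closed p λ {g} → ⊆-closed q λ {h} → assoc⁺ r A g h)
          (⊆-closed p λ {g} → ⊆-closed q λ {h} → assoc⁻ r A g h)
      }
    }
    where
    open Equivalence using (to; from)
    assoc⁺ : ∀ r A g h → h ∈ (g ⁻¹) ·ˡ quotientSet r A →
             h ∈ quotientSet r ((g ⁻¹) ·ˡ A)
    assoc⁺ r A g h m = ⊆-closed r
      (λ {k} k∈ → ∈-translate⁺ h ((g ⁻¹) ·ˡ A) (∈-translate⁺ g A
         (respects A (assoc g h k) (∈-translate⁻ (g ∙ h) A k∈))))
      (∈-translate⁻ g (quotientSet r A) m)
    assoc⁻ : ∀ r A g h → h ∈ quotientSet r ((g ⁻¹) ·ˡ A) →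
             h ∈ (g ⁻¹) ·ˡ quotientSet r A
    assoc⁻ r A g h m = ∈-translate⁺ g (quotientSet r A) (⊆-closed r
      (λ {k} k∈ → ∈-translate⁺ (g ∙ h) A (respects A (sym (assoc g h k))
         (∈-translate⁻ g A (∈-translate⁻ h ((g ⁻¹) ·ˡ A) k∈))))
      m)

  -- The topology on βG with base the sets {p : A ∈ p}, for A a subset of G.
  IsOpen : Pred Ultrafilter ℓ′ → Set (lsuc s ⊔ ℓ′)
  IsOpen O = ∀ p → p ∈ᵤ O →
    ∃ λ A → A ∈ᵤ sets p × (∀ q → A ∈ᵤ sets q → q ∈ᵤ O)

  IsClosed : Pred Ultrafilter ℓ′ → Set (lsuc s ⊔ ℓ′)
  IsClosed F = IsOpen (∁ᵤ F)

  infix 8 _^∧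
  _^∧ : Pred Subset ℓ′ → Pred Ultrafilter (lsuc s ⊔ ℓ′)
  (I ^∧) p = ∀ A → A ∈ᵤ I → ∁ A ∈ᵤ sets p

{-# OPTIONS --safe #-}

-- Part (i) rests on the bipartite Ramsey theorem: one of the two colours of a large
-- rectangle contains a large monochromatic rectangle. Part (ii) follows from the
-- fact that an ultrafilter in BR^∧ has large rectangles in all its members: if h lies
-- in b⁻¹A for every b in a finite product XY, then X(Yh) ⊆ A. Non-emptiness comes from
-- extending the filter dual to BR to an ultrafilter.
-- For (iii), infinitely many common points of n distinct translates of A yield an
-- (n,n)-rectangle in A. For strictness choose z₀, z₁, … greedily, each outside a finite
-- set of words in its predecessors, and take A = {zᵢ zⱼ : i < j ≤ 2i}. If a point of gA ∩ hA
-- is g zᵢ zⱼ = h zₖ zₗ, then g⁻¹h is a word in finitely many z's, so by freshness the largest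
-- index of any other such point is bounded unless j = l; in that case g zᵢ = h zₖ bounds
-- max(i,k), and j ≤ 2 max(i,k). Hence A is 1-thin, and it contains all finite rectangles.
module Submission where

open import Defs
open import Algebra.Bundles using (Group)
import Algebra.Properties.Group as GroupProperties
open import Axiom.ExcludedMiddle using (ExcludedMiddle)
open import Data.Fin.Base using (Fin; toℕ; inject≤)
open import Data.Fin.Properties using (toℕ<n; toℕ-injective; inject≤-injective)
open import Data.List.Base
  using (List; []; _∷_; length; lookup; map; allFin; deduplicate; cartesianProductWith)
open import Data.List.Membership.Setoid.Properties
  using (∈-deduplicate⁺; ∈-map⁺; ∈-cartesianProductWith⁺; ∈-resp-≈)
open import Data.List.Membership.Propositional.Properties using (∈-lookup)
open import Data.List.Properties using (length-tabulate)
open import Data.List.Relation.Binary.Sublist.Propositional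
  using ([]; _∷_; _∷ʳ_; minimum; ⊆-refl; ⊆-trans) renaming (_⊆_ to _⊑_)
open import Data.List.Relation.Binary.Sublist.Propositional.Properties using (All-resp-⊆)
open import Data.List.Relation.Unary.All as All using (All; []; _∷_)
open import Data.List.Relation.Unary.AllPairs using (AllPairs; []; _∷_)
open import Data.List.Relation.Unary.Any as Any using (here; there)
open import Data.List.Relation.Unary.Any.Properties using (lookup-index)
import Data.List.Relation.Unary.Unique.DecSetoid.Properties as UniqueDec
import Data.List.Relation.Unary.Unique.Propositional.Properties as Unique
open import Data.Nat.Base using (ℕ; _+_; _≤_; _<_; s≤s; s≤s⁻¹)
open import Data.Nat.Properties as ℕ using ()
open import Data.Product.Base using (∃; ∃₂; _×_; _,_; proj₁; proj₂)
open import Data.Sum.Base as ⊎ using (_⊎_; inj₁; inj₂)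
open import Function.Base using (_∘_; id)
open import Function.Bundles using (_⇔_; mk⇔; Equivalence; Inverse)
open import Function.Definitions using (Injective)
open import Level using (_⊔_; suc; Level; Lift; lift; lower)
open import Relation.Binary.Bundles using (Setoid; DecSetoid; Poset)
open import Relation.Binary.Definitions using (Decidable; Symmetric; tri<; tri≈; tri>)
open import Relation.Binary.PropositionalEquality as ≡ using (_≡_; refl)
open import Relation.Nullary
  using (¬_; yes; no; True; toWitness; fromWitness; contradiction; decidable-stable)
open import Relation.Nullary.Decidable using (map′; toSum)
open import Relation.Unary using (Pred; _∈_; _⊂_)

private
  variable
    a b ℓ : Level
    A B : Set a

lower-em : ∀ b → ExcludedMiddle (a ⊔ b) → ExcludedMiddle a
lower-em b em {P} = map′ lower lift (em {Lift b P})

-- Lists with distinct entries, and finiteness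

AllPairs-resp-⊒ : {R : A → A → Set ℓ} {xs ys : List A} →
  xs ⊑ ys → AllPairs R ys → AllPairs R xs
AllPairs-resp-⊒ []         []       = []
AllPairs-resp-⊒ (_ ∷ʳ τ)   (_ ∷ rs) = AllPairs-resp-⊒ τ rs
AllPairs-resp-⊒ (refl ∷ τ) (r ∷ rs) = All-resp-⊆ τ r ∷ AllPairs-resp-⊒ τ rs

-- `R` serves as setoid equality for a deduplicated list and as propositional equality for a sublist
-- of `allFin`.
lookup-injective : {R : A → A → Set ℓ} → Symmetric R → {xs : List A} →
  AllPairs (λ x y → ¬ R x y) xs → ∀ i j → R (lookup xs i) (lookup xs j) → i ≡ j
lookup-injective sym (_ ∷ _)  Fin.zero    Fin.zero    _ = refl
lookup-injective sym (x≉ ∷ _) Fin.zero    (Fin.suc j) r =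
  contradiction r (All.lookup x≉ (∈-lookup j))
lookup-injective sym (x≉ ∷ _) (Fin.suc i) Fin.zero    r =
  contradiction (sym r) (All.lookup x≉ (∈-lookup i))
lookup-injective sym (_ ∷ xs) (Fin.suc i) (Fin.suc j) r =
  ≡.cong Fin.suc (lookup-injective sym xs i j r)

-- Deduplication leaves exactly one representative of each class, whose position indexes the class.
covered⇒finite : (S : Setoid a b) → let open Setoid S in
  Decidable _≈_ → (xs : List Carrier) → (∀ x → Any.Any (x ≈_) xs) → Finite S
covered⇒finite S _≟_ xs cover = length ys , record
  { to        = lookup ys
  ; from      = Any.index ∘ cover′
  ; to-cong   = reflexive ∘ ≡.cong (lookup ys)
  ; from-cong = λ {x} {y} x≈y → injective _ _
      (trans (sym (lookup-index (cover′ x))) (trans x≈y (lookup-index (cover′ y))))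
  ; inverse   = (λ { {x} refl → sym (lookup-index (cover′ x)) })
              , (λ {i} {x} x≈ → injective _ _ (trans (sym (lookup-index (cover′ x))) x≈))
  }
  where
  open Setoid S hiding (refl)
  ys : List Carrier
  ys = deduplicate _≟_ xs

  cover′ : ∀ x → Any.Any (x ≈_) ys
  cover′ x = ∈-deduplicate⁺ S _≟_ (λ y≈z x≈z → trans x≈z (sym y≈z)) (cover x)

  injective : ∀ i j → lookup ys i ≈ lookup ys j → i ≡ j
  injective = lookup-injective sym (UniqueDec.deduplicate-! decSetoid xs)
    where
    decSetoid : DecSetoid _ _
    decSetoid = record
      { isDecEquivalence = record { isEquivalence = isEquivalence ; _≟_ = _≟_ } }

-- Bipartite Ramsey theorem

module _ {P Q : Pred A ℓ} (P∪Q : ∀ x → P x ⊎ Q x) where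

  -- Each entry lowers the demand of its own colour by one. The length is the sum of the demands, so
  -- one of them reaches zero before the list runs out.
  pigeonhole : ∀ m n xs → length xs ≡ m + n →
    (∃ λ ys → ys ⊑ xs × length ys ≡ m × All P ys) ⊎
    (∃ λ ys → ys ⊑ xs × length ys ≡ n × All Q ys)
  pigeonhole ℕ.zero    n         xs       eq = inj₁ ([] , minimum xs , refl , [])
  pigeonhole (ℕ.suc m) ℕ.zero    xs       eq = inj₂ ([] , minimum xs , refl , [])
  pigeonhole (ℕ.suc m) (ℕ.suc n) (x ∷ xs) eq with P∪Q x
  ... | inj₁ p = ⊎.map
    (λ (ys , τ , len , ps) → x ∷ ys , refl ∷ τ , ≡.cong ℕ.suc len , p ∷ ps)
    (λ (ys , τ , rest) → ys , x ∷ʳ τ , rest)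
    (pigeonhole m (ℕ.suc n) xs (ℕ.suc-injective eq))
  ... | inj₂ q = ⊎.map
    (λ (ys , τ , rest) → ys , x ∷ʳ τ , rest)
    (λ (ys , τ , len , qs) → x ∷ ys , refl ∷ τ , ≡.cong ℕ.suc len , q ∷ qs)
    (pigeonhole (ℕ.suc m) n xs (≡.trans (ℕ.suc-injective eq) (ℕ.+-suc m n)))

-- The number of columns that suffices for m + k rows when n columns are to be common to the rows
-- kept. The pigeonhole principle splits the sum into enough columns for one of two smaller demands.
ramseyBound : ℕ → ℕ → ℕ → ℕ
ramseyBound n ℕ.zero    k         = n
ramseyBound n (ℕ.suc m) ℕ.zero    = n
ramseyBound n (ℕ.suc m) (ℕ.suc k) = ramseyBound n m (ℕ.suc k) + ramseyBound n (ℕ.suc m) k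

-- Sublists of a duplicate-free list again have distinct entries, so they can index the sides of a
-- rectangle.
Monochromatic : (A → B → Set ℓ) → ℕ → ℕ → List A → List B → Set _
Monochromatic P m n xs ys = ∃₂ λ xs′ ys′ →
  xs′ ⊑ xs × length xs′ ≡ m × ys′ ⊑ ys × length ys′ ≡ n × All (λ x → All (P x) ys′) xs′

module _ {P Q : A → B → Set ℓ} (P∪Q : ∀ x y → P x y ⊎ Q x y) where

  -- Each x, in turn, restricts ys to the points joined to x in a frequent enough colour.
  ramsey : ∀ n m k xs ys → length xs ≡ m + k → length ys ≡ ramseyBound n m k →
    Monochromatic P m n xs ys ⊎ Monochromatic Q k n xs ys
  ramsey n ℕ.zero    k         xs       ys _    ∣ys∣ =
    inj₁ ([] , ys , minimum xs , refl , ⊆-refl , ∣ys∣ , [])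
  ramsey n (ℕ.suc m) ℕ.zero    xs       ys _    ∣ys∣ =
    inj₂ ([] , ys , minimum xs , refl , ⊆-refl , ∣ys∣ , [])
  ramsey n (ℕ.suc m) (ℕ.suc k) (x ∷ xs) ys ∣xs∣ ∣ys∣ with pigeonhole (P∪Q x) _ _ ys ∣ys∣
  ... | inj₁ (zs , σ , ∣zs∣ , ps) = ⊎.map
    (λ (xs′ , ys′ , τ , len , υ , len′ , all) → x ∷ xs′ , ys′ , refl ∷ τ ,
       ≡.cong ℕ.suc len , ⊆-trans υ σ , len′ , All-resp-⊆ υ ps ∷ all)
    (λ (xs′ , ys′ , τ , len , υ , rest) → xs′ , ys′ , x ∷ʳ τ , len , ⊆-trans υ σ , rest)
    (ramsey n m (ℕ.suc k) xs zs (ℕ.suc-injective ∣xs∣) ∣zs∣)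
  ... | inj₂ (zs , σ , ∣zs∣ , qs) = ⊎.map
    (λ (xs′ , ys′ , τ , len , υ , rest) → xs′ , ys′ , x ∷ʳ τ , len , ⊆-trans υ σ , rest)
    (λ (xs′ , ys′ , τ , len , υ , len′ , all) → x ∷ xs′ , ys′ , refl ∷ τ ,
       ≡.cong ℕ.suc len , ⊆-trans υ σ , len′ , All-resp-⊆ υ qs ∷ all)
    (ramsey n (ℕ.suc m) k xs zs (≡.trans (ℕ.suc-injective ∣xs∣) (ℕ.+-suc m k)) ∣zs∣)

-- Rectangles with enumerated sides

module Rectangles {c ℓ} (G : Group c ℓ) where

  open Group G renaming (setoid to ≈-setoid; refl to ≈-refl)
  open GroupSubsets G renaming (_∈_ to _∈ₛ_)
  open GroupProperties G using (∙-cancelˡ; ∙-cancelʳ)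

  -- Enumerations in place of subsets keep the level at `s`, where `em-s` applies, and turn trimming
  -- and shifting into operations on functions.
  Rectangle : ℕ → ℕ → Subset → Set s
  Rectangle n m A = ∃₂ λ (x : Fin n → Carrier) (y : Fin m → Carrier) →
    Injective _≡_ _≈_ x × Injective _≡_ _≈_ y × (∀ i j → (x i ∙ y j) ∈ₛ A)

  image : ∀ {n} → (Fin n → Carrier) → Subset
  image x = ⟨ (λ z → ∃ λ i → Lift s (z ≈ x i))
            , (λ z≈z′ (i , lift z≈) → i , lift (trans (sym z≈z′) z≈)) ⟩

  ∣image∣ : ∀ {n} (x : Fin n → Carrier) → Injective _≡_ _≈_ x →
    HasCardinality n (subsetoid (image x))
  ∣image∣ x inj = record
    { to        = λ i → x i , i , lift ≈-refl
    ; from      = λ (_ , i , _) → i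
    ; to-cong   = reflexive ∘ ≡.cong x
    ; from-cong = λ { {_ , _ , lift p} {_ , _ , lift q} e → inj (trans (sym p) (trans e q)) }
    ; inverse   = (λ { {_ , _ , lift p} refl → sym p })
                , (λ { {_} {_ , _ , lift p} e → inj (trans (sym p) e) })
    }

  enumerate : ∀ {n} X → HasCardinality n (subsetoid X) →
    ∃ λ (x : Fin n → Carrier) → Injective _≡_ _≈_ x × (∀ i → x i ∈ₛ X)
  enumerate X card = proj₁ ∘ to
    , (λ {i} {j} e → ≡.trans (≡.sym (strictlyInverseʳ i))
                       (≡.trans (from-cong e) (strictlyInverseʳ j)))
    , proj₂ ∘ to
    where open Inverse card

  rectangle⇒contains : ∀ {n m} A → Rectangle n m A → ContainsRectangle n m A
  rectangle⇒contains A (x , y , x-inj , y-inj , xy∈) =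
    image x , image y , ∣image∣ x x-inj , ∣image∣ y y-inj ,
    λ (_ , _ , (i , lift a≈) , (j , lift b≈) , z≈) →
      Subset.respects A (sym (trans z≈ (∙-cong a≈ b≈))) (xy∈ i j)

  contains⇒rectangle : ∀ {n m} A → ContainsRectangle n m A → Rectangle n m A
  contains⇒rectangle A (X , Y , ∣X∣ , ∣Y∣ , XY⊆A) =
    let x , x-inj , x∈ = enumerate X ∣X∣
        y , y-inj , y∈ = enumerate Y ∣Y∣
    in x , y , x-inj , y-inj , λ i j → XY⊆A (x i , y j , x∈ i , y∈ j , ≈-refl)

  rectangle-⊆ : ∀ {n m} A B → A ⊆ B → Rectangle n m A → Rectangle n m B
  rectangle-⊆ _ _ A⊆B (x , y , x-inj , y-inj , xy∈) =
    x , y , x-inj , y-inj , λ i j → A⊆B (xy∈ i j)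

  rectangle-≤ : ∀ {n n′ m m′} A → n ≤ n′ → m ≤ m′ → Rectangle n′ m′ A → Rectangle n m A
  rectangle-≤ _ n≤ m≤ (x , y , x-inj , y-inj , xy∈) =
    (λ i → x (inject≤ i n≤)) , (λ j → y (inject≤ j m≤)) ,
    (λ e → inject≤-injective n≤ n≤ _ _ (x-inj e)) ,
    (λ e → inject≤-injective m≤ m≤ _ _ (y-inj e)) ,
    λ i j → xy∈ _ _

  -- By associativity g(XY) = (gX)Y, so only the left side of the rectangle moves.
  rectangle-shiftˡ : ∀ {n m} g A B → (∀ {z} → z ∈ₛ A → (g ∙ z) ∈ₛ B) →
    Rectangle n m A → Rectangle n m B
  rectangle-shiftˡ g A B gA⊆B (x , y , x-inj , y-inj , xy∈) =
    (λ i → g ∙ x i) , y , (λ e → x-inj (∙-cancelˡ g _ _ e)) , y-inj ,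
    λ i j → Subset.respects B (sym (assoc g (x i) (y j))) (gA⊆B (xy∈ i j))

  rectangle-shiftʳ : ∀ {n m} g A B → (∀ {z} → z ∈ₛ A → (z ∙ g) ∈ₛ B) →
    Rectangle n m A → Rectangle n m B
  rectangle-shiftʳ g A B Ag⊆B (x , y , x-inj , y-inj , xy∈) =
    x , (λ j → y j ∙ g) , x-inj , (λ e → y-inj (∙-cancelʳ g _ _ e)) ,
    λ i j → Subset.respects B (assoc (x i) (y j) g) (Ag⊆B (xy∈ i j))

  monochromatic⇒rectangle : ∀ {K L m n} A (x : Fin K → Carrier) (y : Fin L → Carrier) →
    Injective _≡_ _≈_ x → Injective _≡_ _≈_ y →
    Monochromatic (λ i j → (x i ∙ y j) ∈ₛ A) m n (allFin K) (allFin L) → Rectangle m n A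
  monochromatic⇒rectangle {K} {L} A x y x-inj y-inj
    (is , js , τ , refl , υ , refl , all) =
      x ∘ lookup is , y ∘ lookup js
    , (λ e → sublist-injective τ (x-inj e)) , (λ e → sublist-injective υ (y-inj e))
    , λ i j → All.lookup (All.lookup all (∈-lookup i)) (∈-lookup j)
    where
    sublist-injective : ∀ {K} {is : List (Fin K)} → is ⊑ allFin K →
      Injective _≡_ _≡_ (lookup is)
    sublist-injective {K} τ = lookup-injective ≡.sym
      (AllPairs-resp-⊒ τ (Unique.allFin⁺ K)) _ _

  -- The summands of `k` cover the columns and the rows of the Ramsey argument. With n + m common
  -- columns, either colour leaves enough of them to be trimmed to a square.
  rectangle-∪ : ∀ n m A B → let k = ramseyBound (n + m) n m + (n + m) in
    Rectangle k k (A ∪ B) → Rectangle n n A ⊎ Rectangle m m B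
  rectangle-∪ n m A B R
    with x , y , x-inj , y-inj , xy∈ ←
           rectangle-≤ (A ∪ B) (ℕ.m≤n+m (n + m) (ramseyBound (n + m) n m))
             (ℕ.m≤m+n (ramseyBound (n + m) n m) (n + m)) R
    with ramsey (λ i j → xy∈ i j) (n + m) n m
           (allFin _) (allFin _) (length-tabulate id) (length-tabulate id)
  ... | inj₁ mono = inj₁ (rectangle-≤ A ℕ.≤-refl (ℕ.m≤m+n n m)
                      (monochromatic⇒rectangle A x y x-inj y-inj mono))
  ... | inj₂ mono = inj₂ (rectangle-≤ B ℕ.≤-refl (ℕ.m≤n+m m n)
                      (monochromatic⇒rectangle B x y x-inj y-inj mono))

-- Excluded middle, and closure of `BR` under unions and translations

module Classical {c ℓ} (em : ExcludedMiddle (suc (c ⊔ ℓ))) (G : Group c ℓ) where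

  open Group G renaming (setoid to ≈-setoid; refl to ≈-refl)
  open GroupSubsets G renaming (_∈_ to _∈ₛ_)
  open Rectangles G
  open import Data.List.Membership.Setoid ≈-setoid using () renaming (_∈_ to _∈ₗ_; _∉_ to _∉ₗ_)

  em-s : ExcludedMiddle s
  em-s = lower-em (suc s) em

  em-ℓ : ExcludedMiddle ℓ
  em-ℓ = lower-em (suc s) em

  -- Excluded middle makes Set s impredicative, so that filters defined by quantifying over
  -- subsets or over filters still have membership at level s.
  Resized : Set (suc s) → Set s
  Resized P = Lift s (True (em {P}))

  resize : ∀ {P} → P → Resized P
  resize = lift ∘ fromWitness

  unresize : ∀ {P} → Resized P → P
  unresize = toWitness ∘ lower

  ∉BR⇒rectangle : ∀ A → ¬ (A ∈ BR) → ∀ n → Rectangle n n A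
  ∉BR⇒rectangle A A∉BR n = decidable-stable em-s
    (λ ¬R → A∉BR (n , ¬R ∘ contains⇒rectangle A))

  rectangle⇒∉BR : ∀ A → (∀ n → Rectangle n n A) → ¬ (A ∈ BR)
  rectangle⇒∉BR A R (n , ¬R) = ¬R (rectangle⇒contains A (R n))

  BR-reflects : ∀ A B → (∀ n → Rectangle n n A → Rectangle n n B) → B ∈ BR → A ∈ BR
  BR-reflects A B f (n , ¬R) =
    n , ¬R ∘ rectangle⇒contains B ∘ f n ∘ contains⇒rectangle A

  BR-∪ : ∀ A B → A ∈ BR → B ∈ BR → (A ∪ B) ∈ BR
  BR-∪ A B (n , ¬RA) (m , ¬RB) = _ , λ R →
    ⊎.[ ¬RA ∘ rectangle⇒contains A , ¬RB ∘ rectangle⇒contains B ]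
      (rectangle-∪ n m A B (contains⇒rectangle (A ∪ B) R))

  BR-translationInvariant : TranslationInvariant BR
  BR-translationInvariant g A A∈BR =
      BR-reflects (g ·ˡ A) A (λ n → rectangle-shiftˡ (g ⁻¹) (g ·ˡ A) A
        λ (x , x∈A , z≈gx) → Subset.respects A (sym (trans (∙-congˡ z≈gx)
          (\\-leftDividesʳ g x))) x∈A) A∈BR
    , BR-reflects (A ·ʳ g) A (λ n → rectangle-shiftʳ (g ⁻¹) (A ·ʳ g) A
        λ (x , x∈A , z≈xg) → Subset.respects A (sym (trans (∙-congʳ z≈xg)
          (//-rightDividesʳ g x))) x∈A) A∈BR
    where open GroupProperties G using (\\-leftDividesʳ; //-rightDividesʳ)

  -- Ultrafilters

  module _ (p : Ultrafilter) where

    open Ultrafilter p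

    nonempty : ∀ A → A ∈ sets → ∃ λ x → x ∈ₛ A
    nonempty A A∈p = decidable-stable em-s
      (λ ∄ → ∅∉ (⊆-closed (λ x∈A → contradiction (_ , x∈A) ∄) A∈p))

    ∁∉ : ∀ A → A ∈ sets → ¬ (∁ A ∈ sets)
    ∁∉ A A∈p ∁A∈p with x , x∈A , x∉A ← nonempty (A ∩ ∁ A) (∩-closed A∈p ∁A∈p) = x∉A x∈A

    ⋂-closed : ∀ {n} (A : Fin n → Subset) → (∀ i → A i ∈ sets) → ⋂ A ∈ sets
    ⋂-closed {ℕ.zero}  A A∈p = ⊆-closed (λ _ ()) whole∈
    ⋂-closed {ℕ.suc n} A A∈p = ⊆-closed
      (λ (x∈A₀ , x∈A₊) → λ { Fin.zero → x∈A₀ ; (Fin.suc i) → x∈A₊ i })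
      (∩-closed (A∈p Fin.zero) (⋂-closed (A ∘ Fin.suc) (A∈p ∘ Fin.suc)))

    -- A member of `p` that lay in `BR` would have its complement in `p` as well.
    BR^∧⇒rectangle : p ∈ BR ^∧ → ∀ A → A ∈ sets → ∀ n → Rectangle n n A
    BR^∧⇒rectangle p∈ A A∈p = ∉BR⇒rectangle A (∁∉ A A∈p ∘ p∈ A)

    rectangle⇒BR^∧ : (∀ A → A ∈ sets → ∀ n → Rectangle n n A) → p ∈ BR ^∧
    rectangle⇒BR^∧ R A A∈BR with ultra A
    ... | inj₁ A∈p  = contradiction A∈BR (rectangle⇒∉BR A (R A A∈p))
    ... | inj₂ ∁A∈p = ∁A∈p

  BR^∧⇔contains : ∀ p → p ∈ BR ^∧ ⇔
    (∀ P → P ∈ Ultrafilter.sets p → ∀ n → ContainsRectangle n n P)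
  BR^∧⇔contains p = mk⇔
    (λ p∈ P P∈p n → rectangle⇒contains P (BR^∧⇒rectangle p p∈ P P∈p n))
    (λ R → rectangle⇒BR^∧ p (λ P P∈p n → contains⇒rectangle P (R P P∈p n)))

  -- An ultrafilter outside `I ^∧` has a member `A` in `I`, and no ultrafilter containing `A` lies
  -- in `I ^∧`.
  ^∧-closed : (I : Pred Subset (suc s)) → IsClosed (I ^∧)
  ^∧-closed I p p∉ with em {∃ λ A → A ∈ I × A ∈ Ultrafilter.sets p}
  ... | yes (A , A∈I , A∈p) = A , A∈p , λ q A∈q q∈ → ∁∉ q A A∈q (q∈ A A∈I)
  ... | no ∄ = contradiction
    (λ A A∈I → ⊎.[ (λ A∈p → contradiction (A , A∈I , A∈p) ∄) , id ] (Ultrafilter.ultra p A)) p∉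

  ^∧-respects : (I : Pred Subset (suc s)) → ∀ {p q} → p ≈ᵘ q → p ∈ I ^∧ → q ∈ I ^∧
  ^∧-respects I p≈q p∈ A A∈I = Equivalence.to (p≈q (∁ A)) (p∈ A A∈I)

  -- If A ∈ pq, then some g⁻¹A lies in q and has rectangles, which translation by g carries into A.
  BR^∧-absorbˡ : ∀ p q → q ∈ BR ^∧ → (p ∙ᵘ q) ∈ BR ^∧
  BR^∧-absorbˡ p q q∈ = rectangle⇒BR^∧ (p ∙ᵘ q) λ A A∈pq n →
    let g , g⁻¹A∈q = nonempty p (quotientSet q A) A∈pq
    in rectangle-shiftˡ g ((g ⁻¹) ·ˡ A) A (∈-translate⁻ g A)
         (BR^∧⇒rectangle q q∈ ((g ⁻¹) ·ˡ A) g⁻¹A∈q n)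

  BR^∧-absorbʳ : ∀ p q → p ∈ BR ^∧ → (p ∙ᵘ q) ∈ BR ^∧
  BR^∧-absorbʳ p q p∈ = rectangle⇒BR^∧ (p ∙ᵘ q) λ A A∈pq n →
    let x , y , x-inj , y-inj , xy∈ = BR^∧⇒rectangle p p∈ (quotientSet q A) A∈pq n
        -- `T` consists of the h with x_i y_j h ∈ A for all i and j. It is a finite intersection of
        -- members of `q`, hence inhabited.
        T = ⋂ λ i → ⋂ λ j → ((x i ∙ y j) ⁻¹) ·ˡ A
        h , h∈ = nonempty q T (⋂-closed q _ λ i → ⋂-closed q _ (xy∈ i))
    -- The finite product XY is itself a rectangle, and right translation by h carries it into `A`.
    in rectangle-shiftʳ h (image₂ x y) A
         (λ (i , j , lift z≈) → Subset.respects A (∙-congʳ (sym z≈))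
                                  (∈-translate⁻ (x i ∙ y j) A (h∈ i j)))
         (x , y , x-inj , y-inj , λ i j → i , j , lift ≈-refl)
    where
    image₂ : ∀ {n m} → (Fin n → Carrier) → (Fin m → Carrier) → Subset
    image₂ x y = ⟨ (λ z → ∃₂ λ i j → Lift s (z ≈ x i ∙ y j))
                 , (λ z≈z′ (i , j , lift z≈) → i , j , lift (trans (sym z≈z′) z≈)) ⟩

  -- Extension of proper filters to ultrafilters

  record ProperFilter : Set (suc s) where
    field
      sets     : Pred Subset s
      whole∈   : whole ∈ sets
      ∅∉       : ¬ (∅ ∈ sets)
      ⊆-closed : ∀ {A B} → A ⊆ B → A ∈ sets → B ∈ sets
      ∩-closed : ∀ {A B} → A ∈ sets → B ∈ sets → (A ∩ B) ∈ sets

  open ProperFilter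

  _≼_ : ProperFilter → ProperFilter → Set (suc s)
  F ≼ H = ∀ A → A ∈ sets F → A ∈ sets H

  dualFilter : (I : Pred Subset (suc s)) → IsIdeal I → ProperFilter
  dualFilter I ideal = record
    { sets     = λ A → Resized (∁ A ∈ I)
    ; whole∈   = resize (I.⊆-closed (∁ whole) ∅ (λ x∉ → contradiction (lift _) x∉) I.∅∈)
    ; ∅∉       = λ ∅∈ → I.whole∉ (I.⊆-closed whole (∁ ∅) (λ _ ()) (unresize ∅∈))
    ; ⊆-closed = λ {A} {B} A⊆B A∈ →
        resize (I.⊆-closed (∁ B) (∁ A) (λ x∉B x∈A → x∉B (A⊆B x∈A)) (unresize A∈))
    ; ∩-closed = λ {A} {B} A∈ B∈ → resize (I.⊆-closed (∁ (A ∩ B)) (∁ A ∪ ∁ B)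
        (λ {x} x∉ → de-morgan A B x x∉) (I.∪-closed (∁ A) (∁ B) (unresize A∈) (unresize B∈)))
    }
    where
    module I = IsIdeal ideal
    de-morgan : ∀ A B x → x ∈ₛ ∁ (A ∩ B) → x ∈ₛ (∁ A ∪ ∁ B)
    de-morgan A B x x∉ with em-s {x ∈ₛ A}
    ... | yes x∈A = inj₂ (λ x∈B → x∉ (x∈A , x∈B))
    ... | no x∉A  = inj₁ x∉A

  chainUnion : (C : Pred ProperFilter (suc s)) → ∃ C →
    (∀ F H → F ∈ C → H ∈ C → F ≼ H ⊎ H ≼ F) → ProperFilter
  chainUnion C (F₀ , F₀∈C) chain = record
    { sets     = λ A → Resized (∃ λ F → F ∈ C × A ∈ sets F)
    ; whole∈   = resize (F₀ , F₀∈C , whole∈ F₀)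
    ; ∅∉       = λ ∅∈ → let F , _ , ∅∈F = unresize ∅∈ in ∅∉ F ∅∈F
    ; ⊆-closed = λ A⊆B A∈ →
        let F , F∈C , A∈F = unresize A∈ in resize (F , F∈C , ⊆-closed F A⊆B A∈F)
    ; ∩-closed = λ A∈ B∈ → resize (meet (unresize A∈) (unresize B∈))
    }
    where
    meet : ∀ {A B} → (∃ λ F → F ∈ C × A ∈ sets F) → (∃ λ F → F ∈ C × B ∈ sets F) →
      ∃ λ F → F ∈ C × (A ∩ B) ∈ sets F
    meet (F , F∈C , A∈F) (H , H∈C , B∈H) with chain F H F∈C H∈C
    ... | inj₁ F≼H = H , H∈C , ∩-closed H (F≼H _ A∈F) B∈H
    ... | inj₂ H≼F = F , F∈C , ∩-closed F A∈F (H≼F _ B∈H)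

  -- For a filter F, A ∪ B ∈ F says that B ⊇ M ∩ ∁ A for some M ∈ F, without quantifying over sets.
  adjoin∁ : (F : ProperFilter) (A : Subset) → ¬ (A ∈ sets F) → ProperFilter
  adjoin∁ F A A∉F = record
    { sets     = λ B → (A ∪ B) ∈ sets F
    ; whole∈   = ⊆-closed F (λ _ → inj₂ (lift _)) (whole∈ F)
    ; ∅∉       = λ A∪∅∈ → A∉F (⊆-closed F (λ { (inj₁ x∈A) → x∈A }) A∪∅∈)
    ; ⊆-closed = λ B⊆B′ → ⊆-closed F (⊎.map₂ B⊆B′)
    ; ∩-closed = λ A∪B∈ A∪B′∈ → ⊆-closed F
        (λ { (inj₁ x∈A , _)        → inj₁ x∈A
           ; (inj₂ _   , inj₁ x∈A) → inj₁ x∈A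
           ; (inj₂ x∈B , inj₂ x∈B′) → inj₂ (x∈B , x∈B′) })
        (∩-closed F A∪B∈ A∪B′∈)
    }

  module _ (F : ProperFilter) where

    extensions : Poset (suc s) (suc s) (suc s)
    extensions = record
      { Carrier = ∃ λ H → F ≼ H
      ; _≈_     = λ (H , _) (K , _) → H ≼ K × K ≼ H
      ; _≤_     = λ (H , _) (K , _) → H ≼ K
      ; isPartialOrder = record
        { isPreorder = record
          { isEquivalence = record
            { refl  = (λ _ → id) , (λ _ → id)
            ; sym   = λ (H≼K , K≼H) → K≼H , H≼K
            ; trans = λ (H≼K , K≼H) (K≼L , L≼K) →
                (λ A A∈ → K≼L A (H≼K A A∈)) , (λ A A∈ → K≼H A (L≼K A A∈))
            }
          ; reflexive = proj₁
          ; trans     = λ H≼K K≼L A A∈ → K≼L A (H≼K A A∈)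
          }
        ; antisym = _,_
        }
      }

    upperBound : (C : Pred (∃ (F ≼_)) (suc s)) →
      (∀ H K → H ∈ C → K ∈ C → proj₁ H ≼ proj₁ K ⊎ proj₁ K ≼ proj₁ H) →
      ∃ λ (U : ∃ (F ≼_)) → ∀ H → H ∈ C → proj₁ H ≼ proj₁ U
    upperBound C chain with em {∃ C}
    -- The empty chain offers no filter to start a union from, so `F` itself is its bound.
    ... | no C-empty = (F , λ _ → id) , λ H H∈C → contradiction (H , H∈C) C-empty
    ... | yes ((H , F≼H) , H∈C) =
        ( chainUnion (λ K → ∃ λ (F≼K : F ≼ K) → C (K , F≼K)) (H , F≼H , H∈C)
            (λ H K (_ , H∈C) (_ , K∈C) → chain _ _ H∈C K∈C)
        , λ A A∈F → resize (H , (F≼H , H∈C) , F≼H A A∈F))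
      , λ (K , F≼K) K∈C A A∈K → resize (K , (F≼K , K∈C) , A∈K)

    ultrafilter-lemma : Zorn (suc s) →
      ∃ λ p → ∀ A → A ∈ sets F → A ∈ Ultrafilter.sets p
    ultrafilter-lemma zorn = let (M , F≼M) , maximal = zorn extensions upperBound in
      record
        { sets     = sets M
        ; whole∈   = whole∈ M
        ; ∅∉       = ∅∉ M
        ; ⊆-closed = ⊆-closed M
        ; ∩-closed = ∩-closed M
        ; ultra    = ultra M λ H M≼H →
            proj₁ (maximal (H , λ A A∈F → M≼H A (F≼M A A∈F)) M≼H)
        } , F≼M
      where
      -- Adjoining `∁ A` to a maximal `M` that omits `A` gives no larger filter, so `∁ A` was in `M`
      -- already.
      ultra : ∀ M → (∀ H → M ≼ H → H ≼ M) → ∀ A → A ∈ sets M ⊎ ∁ A ∈ sets M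
      ultra M maximal A with em-s {A ∈ sets M}
      ... | yes A∈M = inj₁ A∈M
      ... | no A∉M  = inj₂ (maximal (adjoin∁ M A A∉M) (λ _ → ⊆-closed M inj₂) (∁ A)
        (⊆-closed M (λ {x} _ → toSum (em-s {x ∈ₛ A})) (whole∈ M)))

  ^∧-satisfiable : Zorn (suc s) → (I : Pred Subset (suc s)) → IsIdeal I → ∃ (I ^∧)
  ^∧-satisfiable zorn I ideal with p , F⊆p ← ultrafilter-lemma (dualFilter I ideal) zorn =
    -- By double negation `∁ (∁ A)` is contained in `A`, which puts `∁ A` into the dual filter.
    p , λ A A∈I → F⊆p (∁ A) (resize
      (IsIdeal.⊆-closed ideal (∁ (∁ A)) A (decidable-stable em-s) A∈I))

  -- Greedy choice of sequences

  -- The list may contain points outside `A`, so its entries in `A` are first extracted, each with a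
  -- proof of membership.
  covered-subset⇒finite : ∀ A xs → (∀ {x} → x ∈ₛ A → x ∈ₗ xs) → Finite (subsetoid A)
  covered-subset⇒finite A xs cover =
    covered⇒finite (subsetoid A) (λ _ _ → em-ℓ) (members xs)
      (λ (_ , x∈A) → ∈-members xs x∈A (cover x∈A))
    where
    members : List Carrier → List (∃ (_∈ₛ A))
    members [] = []
    members (x ∷ xs) with em-s {x ∈ₛ A}
    ... | yes x∈A = (x , x∈A) ∷ members xs
    ... | no _    = members xs

    ∈-members : ∀ xs {x} → x ∈ₛ A → x ∈ₗ xs → Any.Any ((x ≈_) ∘ proj₁) (members xs)
    ∈-members (y ∷ xs) x∈A x∈ with em-s {y ∈ₛ A} | x∈
    ... | yes _  | here x≈y  = here x≈y
    ... | yes _  | there x∈′ = there (∈-members xs x∈A x∈′)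
    ... | no y∉A | here x≈y  = contradiction (Subset.respects A x≈y x∈A) y∉A
    ... | no _   | there x∈′ = ∈-members xs x∈A x∈′

  fresh-element : ∀ A → ¬ Finite (subsetoid A) → ∀ xs → ∃ λ x → x ∈ₛ A × x ∉ₗ xs
  fresh-element A A-infinite xs = decidable-stable em-s λ ∄ → A-infinite
    (covered-subset⇒finite A xs λ x∈A → decidable-stable em-s λ x∉xs → ∄ (_ , x∈A , x∉xs))

  -- With `id` this gives distinct points of `A`; with `words` it gives a sequence that avoids
  -- prescribed equations.
  module FreshSequence (A : Subset) (A-infinite : ¬ Finite (subsetoid A))
    (forbidden : List Carrier → List Carrier)
    (xs⊆forbidden : ∀ xs {x} → x ∈ₗ xs → x ∈ₗ forbidden xs) where

    abstract

      prefix : ℕ → List Carrier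
      z : ℕ → Carrier

      prefix ℕ.zero    = []
      prefix (ℕ.suc n) = z n ∷ prefix n

      z n = proj₁ (fresh-element A A-infinite (forbidden (prefix n)))

      z∈A : ∀ n → z n ∈ₛ A
      z∈A n = proj₁ (proj₂ (fresh-element A A-infinite (forbidden (prefix n))))

      z-fresh : ∀ n → z n ∉ₗ forbidden (prefix n)
      z-fresh n = proj₂ (proj₂ (fresh-element A A-infinite (forbidden (prefix n))))

      z∈prefix : ∀ {m n} → m < n → z m ∈ₗ prefix n
      z∈prefix {m} {ℕ.suc n} m<1+n with ℕ.m≤n⇒m<n∨m≡n (s≤s⁻¹ m<1+n)
      ... | inj₁ m<n  = there (z∈prefix m<n)
      ... | inj₂ refl = here ≈-refl

    z-injective : Injective _≡_ _≈_ z
    z-injective {m} {n} e with ℕ.<-cmp m n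
    ... | tri< m<n _ _ = contradiction
      (xs⊆forbidden _ (∈-resp-≈ ≈-setoid e (z∈prefix m<n))) (z-fresh n)
    ... | tri≈ _ m≡n _ = m≡n
    ... | tri> _ _ n<m = contradiction
      (xs⊆forbidden _ (∈-resp-≈ ≈-setoid (sym e) (z∈prefix n<m))) (z-fresh m)

  -- From bounded rectangles to thinness

  BR⊆FT : ∀ {A} → A ∈ BR → A ∈ FT
  -- Every set contains the empty rectangle.
  BR⊆FT {A} (ℕ.zero , ¬R) = contradiction
    (rectangle⇒contains A ((λ ()) , (λ ()) , (λ { {()} }) , (λ { {()} }) , λ ())) ¬R
  -- `Thin n` concerns n + 1 translates, one for each row. A common point z_j of the sets g_i A has
  -- g_i⁻¹ z_j ∈ A, so rows g_i⁻¹ and columns z_j form the excluded square.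
  BR⊆FT {A} (ℕ.suc n , ¬R) = n , λ g g-inj → decidable-stable em-s λ infinite →
    let open FreshSequence (⋂ λ i → g i ·ˡ A) infinite id (λ _ → id)
    in ¬R (rectangle⇒contains A
      ( _⁻¹ ∘ g , z ∘ toℕ , g-inj ∘ ⁻¹-injective , toℕ-injective ∘ z-injective
      , λ i j → let x , x∈A , z≈gx = z∈A (toℕ j) i in
          Subset.respects A (sym (trans (∙-congˡ z≈gx) (\\-leftDividesʳ (g i) x))) x∈A))
    where open GroupProperties G using (⁻¹-injective; \\-leftDividesʳ)

  whole-infinite : Infinite → ¬ Finite (subsetoid whole)
  whole-infinite infinite (n , card) = infinite (n , record
    { to        = proj₁ ∘ to
    ; from      = λ x → from (x , lift _)
    ; to-cong   = to-cong
    ; from-cong = from-cong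
    ; inverse   = (λ { refl → Inverse.inverseˡ card refl }) , Inverse.inverseʳ card
    })
    where open Inverse card using (to; from; to-cong; from-cong)

  -- A 1-thin set with unbounded rectangles

  module SparseSet (infinite : Infinite) where

    open GroupProperties G

    abstract

      -- `words xs` collects the solutions x of u x = h v, where u is an entry or ε, h is a quotient
      -- of two pairs and v is a pair. Including ε admits shorter products.
      pairs quotients words : List Carrier → List Carrier
      pairs xs     = cartesianProductWith _∙_ (ε ∷ xs) (ε ∷ xs)
      quotients xs = cartesianProductWith _//_ (pairs xs) (pairs xs)
      words xs     = cartesianProductWith _\\_ (ε ∷ xs)
                       (cartesianProductWith _∙_ (quotients xs) (pairs xs))

      ∈-pairs : ∀ {xs x y} → x ∈ₗ (ε ∷ xs) → y ∈ₗ (ε ∷ xs) → (x ∙ y) ∈ₗ pairs xs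
      ∈-pairs = ∈-cartesianProductWith⁺ ≈-setoid ≈-setoid ≈-setoid ∙-cong

      ∈-quotients : ∀ {xs h x y} → x ∈ₗ pairs xs → y ∈ₗ pairs xs → h ∙ y ≈ x →
        h ∈ₗ quotients xs
      ∈-quotients x∈ y∈ hy≈x = ∈-resp-≈ ≈-setoid (sym (x≈z//y _ _ _ hy≈x))
        (∈-cartesianProductWith⁺ ≈-setoid ≈-setoid ≈-setoid //-cong₂ x∈ y∈)

      ∈-words : ∀ {xs u h v x} → u ∈ₗ (ε ∷ xs) → h ∈ₗ quotients xs → v ∈ₗ pairs xs →
        u ∙ x ≈ h ∙ v → x ∈ₗ words xs
      ∈-words u∈ h∈ v∈ ux≈hv = ∈-resp-≈ ≈-setoid (sym (y≈x\\z _ _ _ ux≈hv))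
        (∈-cartesianProductWith⁺ ≈-setoid ≈-setoid ≈-setoid \\-cong₂ u∈
          (∈-cartesianProductWith⁺ ≈-setoid ≈-setoid ≈-setoid ∙-cong h∈ v∈))

    -- Each x solves ε x = h v with h = ε and v = ε x.
    xs⊆words : ∀ xs {x} → x ∈ₗ xs → x ∈ₗ words xs
    xs⊆words xs x∈ = ∈-words (here ≈-refl)
      (∈-quotients (∈-pairs ε∈ ε∈) (∈-pairs ε∈ ε∈) (identityˡ (ε ∙ ε)))
      (∈-pairs ε∈ (there x∈)) (∙-congˡ (sym (identityˡ _)))
      where
      ε∈ : ε ∈ₗ (ε ∷ xs)
      ε∈ = here ≈-refl

    open FreshSequence whole (whole-infinite infinite) words xs⊆words

    -- The condition `j ≤ i + i` leaves finitely many j for each i, yet enough room for squares of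
    -- any size.
    sparse : Subset
    sparse = ⟨ (λ x → ∃₂ λ i j → i < j × j ≤ i + i × Lift s (x ≈ z i ∙ z j))
             , (λ x≈y (i , j , i<j , j≤2i , lift x≈) →
                  i , j , i<j , j≤2i , lift (trans (sym x≈y) x≈)) ⟩

    sparse-rectangle : ∀ n → Rectangle n n sparse
    sparse-rectangle n =
        -- Rows have index 2n + a and columns 3n + b with a, b < n. Rows thus precede columns, and
        -- 3n + b ≤ 4n ≤ 2(2n + a).
        (λ a → z (n + n + toℕ a)) , (λ b → z (n + n + (n + toℕ b)))
      , toℕ-injective ∘ ℕ.+-cancelˡ-≡ (n + n) _ _ ∘ z-injective
      , toℕ-injective ∘ ℕ.+-cancelˡ-≡ n _ _ ∘ ℕ.+-cancelˡ-≡ (n + n) _ _ ∘ z-injective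
      , λ a b → _ , _
        , ℕ.+-monoʳ-< (n + n) (ℕ.<-≤-trans (toℕ<n a) (ℕ.m≤m+n n (toℕ b)))
        , ℕ.≤-trans (ℕ.+-monoʳ-≤ (n + n) (ℕ.+-monoʳ-≤ n (ℕ.<⇒≤ (toℕ<n b))))
            (ℕ.+-mono-≤ (ℕ.m≤m+n (n + n) (toℕ a)) (ℕ.m≤m+n (n + n) (toℕ a)))
        , lift ≈-refl

    record Collision (g h : Carrier) : Set ℓ where
      constructor collision
      field
        {i j k l} : ℕ
        i<j       : i < j
        j≤2i      : j ≤ i + i
        k<l       : k < l
        l≤2k      : l ≤ k + k
        equal     : g ∙ (z i ∙ z j) ≈ h ∙ (z k ∙ z l)

    open Collision

    swap : ∀ {g h} → Collision g h → Collision h g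
    swap (collision i<j j≤2i k<l l≤2k e) = collision k<l l≤2k i<j j≤2i (sym e)

    quotient : ∀ {g h x y} → g ∙ x ≈ h ∙ y → x ≈ (g \\ h) ∙ y
    quotient {g} {h} {x} {y} e = trans (y≈x\\z g x (h ∙ y) e) (sym (assoc (g ⁻¹) h y))

    z∈ε∷prefix : ∀ {m n} → m < n → z m ∈ₗ (ε ∷ prefix n)
    z∈ε∷prefix = there ∘ z∈prefix

    -- Exceeds all four indices, since i < j and k < l.
    bound : ∀ {g h} → Collision g h → ℕ
    bound r = ℕ.suc (j r + l r)

    -- The collision `r` expresses g⁻¹h as (z_i z_j)(z_k z_l)⁻¹.
    quotient∈ : ∀ {g h m} (r : Collision g h) → bound r ≤ m → (g \\ h) ∈ₗ quotients (prefix m)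
    quotient∈ {m = m} r r≤m = ∈-quotients
      (∈-pairs (z∈ε∷prefix (ℕ.<-trans (i<j r) j<m)) (z∈ε∷prefix j<m))
      (∈-pairs (z∈ε∷prefix (ℕ.<-trans (k<l r) l<m)) (z∈ε∷prefix l<m))
      (sym (quotient (equal r)))
      where
      j<m : j r < m
      j<m = ℕ.<-≤-trans (s≤s (ℕ.m≤m+n (j r) (l r))) r≤m
      l<m : l r < m
      l<m = ℕ.<-≤-trans (s≤s (ℕ.m≤n+m (l r) (j r))) r≤m

    -- Were `bound r ≤ m`, then g⁻¹h would be a quotient over the entries before `z m`, and `z m`
    -- would solve an equation forbidden to it.
    equation-bound : ∀ {g h} (r : Collision g h) {m u v} →
      u ∈ₗ (ε ∷ prefix m) → v ∈ₗ pairs (prefix m) → u ∙ z m ≈ (g \\ h) ∙ v → m < bound r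
    equation-bound r u∈ v∈ e = ℕ.≰⇒> λ r≤m →
      z-fresh _ (∈-words u∈ (quotient∈ r r≤m) v∈ e)

    -- In z_i z_j = g⁻¹h z_k z_l the factor z_j is newer than all the others.
    j-bound : ∀ {g h} (r r′ : Collision g h) → l r′ < j r′ → j r′ < bound r
    j-bound r r′ l<j = equation-bound r (z∈ε∷prefix (i<j r′))
      (∈-pairs (z∈ε∷prefix (ℕ.<-trans (k<l r′) l<j)) (z∈ε∷prefix l<j)) (quotient (equal r′))

    cancelled : ∀ {g h} (r : Collision g h) → j r ≡ l r → g ∙ z (i r) ≈ h ∙ z (k r)
    cancelled {g} {h} (collision {j = j} _ _ _ _ e) refl =
      ∙-cancelʳ (z j) _ _ (trans (assoc g _ _) (trans e (sym (assoc h _ _))))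

    -- Cancelling the equal last factors leaves z_i = g⁻¹h z_k, where z_i is the newest; hence u =
    -- ε.
    i-bound : ∀ {g h} (r r′ : Collision g h) → j r′ ≡ l r′ → k r′ < i r′ → i r′ < bound r
    i-bound {g} {h} r r′ j≡l k<i = equation-bound r (here ≈-refl)
      (∈-pairs (here ≈-refl) (z∈ε∷prefix k<i))
      (trans (identityˡ _) (trans (quotient (cancelled r′ j≡l)) (∙-congˡ (sym (identityˡ _)))))

    bound-swap : ∀ {g h n} (r : Collision g h) → n < bound (swap r) → n < bound r
    bound-swap {n = n} r = ≡.subst (λ m → n < ℕ.suc m) (ℕ.+-comm (l r) (j r))

    doubled : ∀ {j i n} → j ≤ i + i → i < n → j < n + n
    doubled j≤2i i<n = ℕ.≤-<-trans j≤2i (ℕ.+-mono-< i<n i<n)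

    collision-bound : ∀ {g h} → ¬ g ≈ h → (r r′ : Collision g h) → j r′ < bound r + bound r
    collision-bound g≉h r r′ with ℕ.<-cmp (j r′) (l r′)
    ... | tri< j<l _ _ = ℕ.<-≤-trans
      (ℕ.<-trans j<l (bound-swap r (j-bound (swap r) (swap r′) j<l))) (ℕ.m≤m+n _ _)
    ... | tri> _ _ l<j = ℕ.<-≤-trans (j-bound r r′ l<j) (ℕ.m≤m+n _ _)
    ... | tri≈ _ j≡l _ with ℕ.<-cmp (i r′) (k r′)
    -- Here k is bounded, and j = l ≤ 2k.
    ...   | tri< i<k _ _ = doubled (≡.subst (_≤ _) (≡.sym j≡l) (l≤2k r′))
      (bound-swap r (i-bound (swap r) (swap r′) (≡.sym j≡l) i<k))
    -- Both factors agree, so cancelling them would give g = h.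
    ...   | tri≈ _ i≡k _ = contradiction
      (∙-cancelʳ _ _ _ (trans (cancelled r′ j≡l) (∙-congˡ (reflexive (≡.cong z (≡.sym i≡k)))))) g≉h
    ...   | tri> _ _ k<i = doubled (j≤2i r′) (i-bound r r′ j≡l k<i)

    module _ (g : Fin 2 → Carrier) (g-inj : Injective _≡_ _≈_ g) where

      g₀ g₁ : Carrier
      g₀ = g Fin.zero
      g₁ = g (Fin.suc Fin.zero)

      common : Subset
      common = ⋂ λ i → g i ·ˡ sparse

      common⇒collision : ∀ {x} → x ∈ₛ common →
        ∃ λ (r : Collision g₀ g₁) → x ≈ g₀ ∙ (z (i r) ∙ z (j r))
      common⇒collision x∈
        with y , (_ , _ , i<j , j≤2i , lift y≈) , x≈g₀y ← x∈ Fin.zero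
        with y′ , (_ , _ , k<l , l≤2k , lift y′≈) , x≈g₁y′ ← x∈ (Fin.suc Fin.zero)
        = let x≈ = trans x≈g₀y (∙-congˡ y≈)
          in collision i<j j≤2i k<l l≤2k (trans (sym x≈) (trans x≈g₁y′ (∙-congˡ y′≈))) , x≈

      -- A single collision `r` bounds all others, so every common point is g₀ z_i z_j with i and j
      -- below twice `bound r`.
      common-finite : Finite (subsetoid common)
      common-finite with em-ℓ {Collision g₀ g₁}
      ... | no ∄ = covered-subset⇒finite common []
        λ x∈ → contradiction (proj₁ (common⇒collision x∈)) ∄
      ... | yes r = covered-subset⇒finite common
        (map (g₀ ∙_) (pairs (prefix (bound r + bound r)))) λ x∈ →
          let r′ , x≈ = common⇒collision x∈
              j< = collision-bound (λ e → contradiction (g-inj e) (λ ())) r r′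
          in ∈-resp-≈ ≈-setoid (sym x≈) (∈-map⁺ ≈-setoid ≈-setoid ∙-congˡ
               (∈-pairs (z∈ε∷prefix (ℕ.<-trans (i<j r′) j<)) (z∈ε∷prefix j<)))

    sparse-thin : Thin 1 sparse
    sparse-thin = common-finite

    -- This makes the ideal `BR` proper.
    whole-rectangle : ∀ n → Rectangle n n whole
    whole-rectangle n = rectangle-⊆ sparse whole (λ _ → lift _) (sparse-rectangle n)

  -- The ideals given by `BR`, and strictness of the inclusion in `FT`

  BR-isIdeal : Infinite → IsIdeal BR
  BR-isIdeal infinite = record
    { ∅∈       = 1 , λ R → let _ , _ , _ , _ , xy∈ = contains⇒rectangle ∅ R in
        lower (xy∈ Fin.zero Fin.zero)
    ; ∪-closed = BR-∪
    ; ⊆-closed = λ A B A⊆B → BR-reflects A B (λ n → rectangle-⊆ A B A⊆B)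
    ; whole∉   = rectangle⇒∉BR whole (SparseSet.whole-rectangle infinite)
    }

  BR⊂FT : Infinite → BR ⊂ FT
  BR⊂FT infinite = (λ {A} → BR⊆FT {A}) , λ FT⊆BR →
    rectangle⇒∉BR sparse sparse-rectangle (FT⊆BR {sparse} (1 , sparse-thin))
    where open SparseSet infinite

  BR^∧-isSemigroupIdeal : Zorn (suc s) → Infinite → IsSemigroupIdeal βG (BR ^∧)
  BR^∧-isSemigroupIdeal zorn infinite = record
    { respects = λ {p} {q} → ^∧-respects BR {p} {q}
    ; nonempty = ^∧-satisfiable zorn BR (BR-isIdeal infinite)
    ; absorbˡ  = BR^∧-absorbˡ
    ; absorbʳ  = BR^∧-absorbʳ
    }

theorem6p7 : ∀ {c ℓ} → ExcludedMiddle (suc (c ⊔ ℓ)) → Zorn (suc (c ⊔ ℓ)) →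
    (G : Group c ℓ) → let open GroupSubsets G hiding (_∈_) in Infinite →
    (IsIdeal BR × TranslationInvariant BR) ×
    ((IsClosed (BR ^∧) × IsSemigroupIdeal βG (BR ^∧)) ×
    (∀ (p : Ultrafilter) →
    p ∈ BR ^∧ ⇔ (∀ P → P ∈ Ultrafilter.sets p → ∀ (n : ℕ) → ContainsRectangle n n P))) ×
    (BR ⊂ FT)
theorem6p7 em zorn G infinite =
    (BR-isIdeal infinite , BR-translationInvariant)
  , ((^∧-closed _ , BR^∧-isSemigroupIdeal zorn infinite) , BR^∧⇔contains)
  , BR⊂FT infinite
  where open Classical em G
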